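{- Let $S\subseteq \mathit{Fm}$ be any set of formulas and let $F\in\mathit{Fm}$. Then $S\vdash F$ if and only if $F$ is true in every basic model of $S$ (i.e. $\models_\ast F$ for every $\ast\in \mathit{BM}(S)$).
   Context: The language consists of two disjoint sets of syntactic objects: a set $\mathit{Tm}$ of justification terms (arbitrary), and a set $\mathit{Fm}$ of formulas, built inductively from propositional atoms using Boolean connectives and the following rule: if $F\in\mathit{Fm}$ and $t\in\mathit{Tm}$, then $t{:}F\in\mathit{Fm}$ (read "$t$ is a justification of $F$"). A basic model $\ast$ consists of two maps, both denoted $\ast$: a map $\ast:\mathit{Fm}\to\{0,1\}$ and a map $\ast:\mathit{Tm}\to 2^{\mathit{Fm}}$ (justification terms are interpreted as sets of formulas), such that (i) $(X\to Y)^\ast=1$ iff $X^\ast=0$ or $Y^\ast=1$, and similarly the other Boolean connectives have their classical truth-table behaviour; (ii) writing $\models_\ast X$ for $X^\ast=1$, for every $X\in\mathit{Fm}$ and $t\in\mathit{Tm}$: $\models_\ast t{:}X$ if and only if $X\in t^\ast$. $S\vdash X$ means that $X$ is derivable from the set $S$ of formulas in classical propositional logic, treating justification assertions $t{:}F$ as propositional atoms, with Modus Ponens as the only rule of inference. A basic model $\ast$ is a basic model of $S$ if $\models_\ast X$ for all $X\in S$. $\mathit{BM}(S)$ denotes the class of all basic models of $S$. -}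

module Defs where

open import Data.Bool.Base using (Bool; true; false)
open import Data.Product.Base using (_×_)
open import Data.Sum.Base using (_⊎_)
open import Function.Bundles using (_⇔_)
open import Level using (0ℓ)
open import Relation.Binary.PropositionalEquality.Core using (_≡_)
open import Relation.Unary using (Pred; _∈_)

infix  25 _∶_
infix  24 ∼_
infixr 22 _∧_
infixr 21 _∨_
infixr 20 _⇒_
infix  4  _⊢_ _⊨_

data Fm (Atom Tm : Set) : Set where
  atom        : Atom → Fm Atom Tm
  ∼_          : Fm Atom Tm → Fm Atom Tm
  _∧_ _∨_ _⇒_ : Fm Atom Tm → Fm Atom Tm → Fm Atom Tm
  _∶_         : Tm → Fm Atom Tm → Fm Atom Tm

private
  variable
    Atom Tm : Set
    X Y Z   : Fm Atom Tm

-- Kleene's axiom schemata for classical propositional logic.  No schema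
-- mentions _∶_, so the formulas t ∶ X behave as additional atoms.
data Axiom {Atom Tm : Set} : Pred (Fm Atom Tm) 0ℓ where
  ⇒-K   : Axiom (X ⇒ Y ⇒ X)
  ⇒-S   : Axiom ((X ⇒ Y ⇒ Z) ⇒ (X ⇒ Y) ⇒ X ⇒ Z)
  ∧-I   : Axiom (X ⇒ Y ⇒ X ∧ Y)
  ∧-E₁  : Axiom (X ∧ Y ⇒ X)
  ∧-E₂  : Axiom (X ∧ Y ⇒ Y)
  ∨-I₁  : Axiom (X ⇒ X ∨ Y)
  ∨-I₂  : Axiom (Y ⇒ X ∨ Y)
  ∨-E   : Axiom ((X ⇒ Z) ⇒ (Y ⇒ Z) ⇒ X ∨ Y ⇒ Z)
  ∼-I   : Axiom ((X ⇒ Y) ⇒ (X ⇒ ∼ Y) ⇒ ∼ X)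
  ∼∼-E  : Axiom (∼ ∼ X ⇒ X)

data _⊢_ {Atom Tm : Set} (S : Pred (Fm Atom Tm) 0ℓ) : Pred (Fm Atom Tm) 0ℓ where
  hyp : X ∈ S → S ⊢ X
  ax  : Axiom X → S ⊢ X
  mp  : S ⊢ X ⇒ Y → S ⊢ X → S ⊢ Y

record BasicModel (Atom Tm : Set) : Set₁ where
  field
    ⟦_⟧ : Fm Atom Tm → Bool
    ⟪_⟫ : Tm → Pred (Fm Atom Tm) 0ℓ
    ∼-true : ∀ X   → ⟦ ∼ X ⟧   ≡ true ⇔ ⟦ X ⟧ ≡ false
    ∧-true : ∀ X Y → ⟦ X ∧ Y ⟧ ≡ true ⇔ (⟦ X ⟧ ≡ true × ⟦ Y ⟧ ≡ true)
    ∨-true : ∀ X Y → ⟦ X ∨ Y ⟧ ≡ true ⇔ (⟦ X ⟧ ≡ true ⊎ ⟦ Y ⟧ ≡ true)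
    ⇒-true : ∀ X Y → ⟦ X ⇒ Y ⟧ ≡ true ⇔ (⟦ X ⟧ ≡ false ⊎ ⟦ Y ⟧ ≡ true)
    ∶-true : ∀ t X → ⟦ t ∶ X ⟧ ≡ true ⇔ X ∈ ⟪ t ⟫

_⊨_ : BasicModel Atom Tm → Fm Atom Tm → Set
M ⊨ X = BasicModel.⟦_⟧ M X ≡ true

BM : Pred (Fm Atom Tm) 0ℓ → Pred (BasicModel Atom Tm) 0ℓ
BM S M = ∀ X → X ∈ S → M ⊨ X

{-# OPTIONS --safe #-}
-- Completeness: if S ⊬ F, extend S by a set M maximal among those with
-- S ∪ M ⊬ F.  Membership in M is then a Boolean valuation, and reading
-- t* as { X | t ∶ X ∈ M } makes it a basic model of S refuting F.
--
-- The maximal set exists for arbitrary (possibly uncountable) languages because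
-- ExcludedMiddle decides every type in Set, not only propositions, so it acts as
-- a choice operator.  Subsets are Bool-valued to keep power sets inside Set.
module Submission where

open import Defs
open import Axiom.ExcludedMiddle using (ExcludedMiddle)
open import Axiom.Extensionality.Propositional using (Extensionality)
open import Data.Bool.Base using (Bool; true; false)
open import Data.Bool.Properties using (¬-not)
open import Data.Empty using (⊥-elim)
open import Data.List.Base using (List; []; _∷_; [_]; _++_)
open import Data.List.Membership.Propositional using () renaming (_∈_ to _∈ˡ_)
open import Data.List.Membership.Propositional.Properties using (∈-++⁺ˡ; ∈-++⁺ʳ)
open import Data.List.Relation.Unary.All as All using (All; []; _∷_)
open import Data.List.Relation.Unary.All.Properties using (++⁺)
open import Data.List.Relation.Unary.Any using (here)
open import Data.Product.Base using (∃; _×_; _,_; proj₁; proj₂)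
open import Data.Sum.Base as Sum using (_⊎_; inj₁; inj₂; [_,_]′)
open import Function.Base using (id; _∘_)
open import Function.Bundles using (_⇔_; mk⇔; module Equivalence)
open import Level using (0ℓ)
open import Relation.Binary.PropositionalEquality using (_≡_; refl; sym)
open import Relation.Nullary using (¬_; Dec; yes; no; does)
open import Relation.Unary using (Pred; _∈_; _∪_; ｛_｝)

open Equivalence using (to; from)

private
  variable
    Atom Tm : Set
    X Y Z   : Fm Atom Tm
    S S′    : Pred (Fm Atom Tm) 0ℓ

true≢false : ∀ {b} → b ≡ true → ¬ b ≡ false
true≢false refl ()

-- Maximal sets of finite character

Subset : Set → Set
Subset A = A → Bool

infix 4 _⊑_

_⊑_ : {A : Set} → Subset A → Subset A → Set
p ⊑ q = ∀ x → p x ≡ true → q x ≡ true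

⊑-trans : {A : Set} {p q r : Subset A} → p ⊑ q → q ⊑ r → p ⊑ r
⊑-trans p⊑q q⊑r x = q⊑r x ∘ p⊑q x

module Choice (em : ExcludedMiddle 0ℓ) (ext : Extensionality 0ℓ 0ℓ) where

  ⌊_⌋ : {A : Set} → (A → Set) → Subset A
  ⌊ P ⌋ x = does (em {P x})

  ∈⌊⌋⁺ : {A : Set} (P : A → Set) {x : A} → P x → ⌊ P ⌋ x ≡ true
  ∈⌊⌋⁺ P {x} Px with em {P x}
  ... | yes _  = refl
  ... | no ¬Px = ⊥-elim (¬Px Px)

  ∈⌊⌋⁻ : {A : Set} (P : A → Set) {x : A} → ⌊ P ⌋ x ≡ true → P x
  ∈⌊⌋⁻ P {x} eq with em {P x}
  ... | yes Px = Px

  -- The map `f` iterated below is not assumed monotone, so mutual inclusion of `p` and `q` relates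
  -- `f p` to `f q` only once it has become an equality.
  ⊑-antisym : {A : Set} {p q : Subset A} → p ⊑ q → q ⊑ p → p ≡ q
  ⊑-antisym {p = p} {q} p⊑q q⊑p = ext λ x → bool-ext (p x) (q x) (p⊑q x) (q⊑p x)
    where
    bool-ext : ∀ a b → (a ≡ true → b ≡ true) → (b ≡ true → a ≡ true) → a ≡ b
    bool-ext true  b     f g = sym (f refl)
    bool-ext false false f g = refl
    bool-ext false true  f g = g refl

  CoveredBy : {A : Set} → Subset (Subset A) → A → Set
  CoveredBy 𝒫 x = ∃ λ p → 𝒫 p ≡ true × p x ≡ true

  ⋃ : {A : Set} → Subset (Subset A) → Subset A
  ⋃ 𝒫 = ⌊ CoveredBy 𝒫 ⌋

  module _ {A : Set} {𝒫 : Subset (Subset A)} where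

    ⋃-upper : ∀ p → 𝒫 p ≡ true → p ⊑ ⋃ 𝒫
    ⋃-upper p p∈𝒫 x x∈p = ∈⌊⌋⁺ (CoveredBy 𝒫) (p , p∈𝒫 , x∈p)

    ∈⋃⁻ : ∀ {x} → ⋃ 𝒫 x ≡ true → CoveredBy 𝒫 x
    ∈⋃⁻ = ∈⌊⌋⁻ (CoveredBy 𝒫)

    ⋃-least : ∀ q → (∀ p → 𝒫 p ≡ true → p ⊑ q) → ⋃ 𝒫 ⊑ q
    ⋃-least q below x x∈⋃ with ∈⋃⁻ x∈⋃
    ... | p , p∈𝒫 , x∈p = below p p∈𝒫 x x∈p

    -- Used at unions, to pass from comparisons with the single members to a comparison with the
    -- whole union.
    ∀⊎∃ : {P Q : Subset A → Set} → (∀ p → 𝒫 p ≡ true → P p ⊎ Q p) →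
          (∀ p → 𝒫 p ≡ true → P p) ⊎ ∃ λ p → 𝒫 p ≡ true × Q p
    ∀⊎∃ {Q = Q} P⊎Q with em {∃ λ p → 𝒫 p ≡ true × Q p}
    ... | yes ∃Q = inj₂ ∃Q
    ... | no ¬∃Q = inj₁ λ p p∈𝒫 →
      [ id , (λ Qp → ⊥-elim (¬∃Q (p , p∈𝒫 , Qp))) ]′ (P⊎Q p p∈𝒫)

  -- The tower of an inflationary map is a chain (Bourbaki–Witt), so its
  -- union is closed under the map.
  module Iterate {A : Set} (f : Subset A → Subset A) (inflationary : ∀ p → p ⊑ f p) where

    -- Replaces iteration along the ordinals. The empty family in `limit` yields the empty set as
    -- starting stage.
    data Tower : Subset A → Set where
      next  : ∀ {p} → Tower p → Tower (f p)
      limit : ∀ 𝒫 → (∀ p → 𝒫 p ≡ true → Tower p) → Tower (⋃ 𝒫)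

    -- An extreme point in the Bourbaki-Witt sense: `f` does not lead past `q` from strictly below.
    -- The alternative `q ⊑ p` covers the case of equality.
    Extreme : Subset A → Set
    Extreme q = ∀ {p} → Tower p → p ⊑ q → q ⊑ p ⊎ f p ⊑ q

    -- Induction on the stage `p`: a step from strictly below `q` cannot jump over `q`, and a step
    -- from `q` itself lands on `f q`.
    extreme-comparable : ∀ {q} → Extreme q → ∀ {p} → Tower p → p ⊑ q ⊎ f q ⊑ p
    extreme-comparable {q} ex (next {p} tp) with extreme-comparable ex tp
    ... | inj₂ fq⊑p = inj₂ (⊑-trans fq⊑p (inflationary p))
    ... | inj₁ p⊑q with ex tp p⊑q
    ...   | inj₂ fp⊑q = inj₁ fp⊑q
    ...   | inj₁ q⊑p rewrite ⊑-antisym p⊑q q⊑p = inj₂ λ _ → id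
    extreme-comparable {q} ex (limit 𝒫 ts)
      with ∀⊎∃ (λ p p∈𝒫 → extreme-comparable ex (ts p p∈𝒫))
    ... | inj₁ below            = inj₁ (⋃-least q below)
    ... | inj₂ (p , p∈𝒫 , fq⊑p) = inj₂ (⊑-trans fq⊑p (⋃-upper p p∈𝒫))

    extreme : ∀ {q} → Tower q → Extreme q
    extreme (next {q} tq) tp p⊑fq with extreme-comparable (extreme tq) tp
    ... | inj₂ fq⊑p = inj₁ fq⊑p
    ... | inj₁ p⊑q with extreme tq tp p⊑q
    ...   | inj₂ fp⊑q = inj₂ (⊑-trans fp⊑q (inflationary q))
    ...   | inj₁ q⊑p rewrite ⊑-antisym p⊑q q⊑p = inj₂ λ _ → id
    extreme (limit 𝒫 ts) {p} tp p⊑⋃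
      with ∀⊎∃ (λ q q∈𝒫 → Sum.swap (extreme-comparable (extreme (ts q q∈𝒫)) tp))
    ... | inj₁ above = inj₁ (⋃-least p λ q q∈𝒫 → ⊑-trans (inflationary q) (above q q∈𝒫))
    ... | inj₂ (q , q∈𝒫 , p⊑q) with extreme (ts q q∈𝒫) tp p⊑q
    ...   | inj₂ fp⊑q = inj₂ (⊑-trans fp⊑q (⋃-upper q q∈𝒫))
    -- Here `p` equals the member `q`. As `q` is extreme, the union either lies within `q` or
    -- contains `f q`, which is `f p`.
    ...   | inj₁ q⊑p with extreme-comparable (extreme (ts q q∈𝒫)) (limit 𝒫 ts)
    ...     | inj₁ ⋃⊑q = inj₁ (⊑-trans ⋃⊑q q⊑p)
    ...     | inj₂ fq⊑⋃ rewrite ⊑-antisym p⊑q q⊑p = inj₂ fq⊑⋃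

    tower-total : ∀ {p q} → Tower p → Tower q → p ⊑ q ⊎ q ⊑ p
    tower-total {q = q} tp tq =
      Sum.map₂ (⊑-trans (inflationary q)) (extreme-comparable (extreme tq) tp)

    top : Subset A
    top = ⋃ ⌊ Tower ⌋

    tower-top : Tower top
    tower-top = limit ⌊ Tower ⌋ λ _ → ∈⌊⌋⁻ Tower

    -- The union of all stages is a stage, hence so is its image, which is therefore among the sets
    -- joined in `top`.
    top-closed : f top ⊑ top
    top-closed = ⋃-upper (f top) (∈⌊⌋⁺ Tower (next tower-top))

  -- Teichmüller–Tukey lemma
  module _ {A : Set} (Q : List A → Set) (Q[] : Q []) where

    -- Finite character is built in: only finite lists are tested, so admissibility survives the
    -- union of a chain.
    Admissible : Pred A 0ℓ → Set
    Admissible P = ∀ {xs} → All P xs → Q xs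

    ⟨_⟩ : Subset A → Pred A 0ℓ
    ⟨ p ⟩ x = p x ≡ true

    Extension : Subset A → Set
    Extension p = ∃ λ x → ¬ x ∈ ⟨ p ⟩ × Admissible (⟨ p ⟩ ∪ ｛ x ｝)

    -- The new point is the witness carried by the decision, so `em` acts as the choice function.
    -- The decision is an argument so that the lemmas can split on it.
    extend : ∀ p → Dec (Extension p) → Subset A
    extend p (yes (x , _)) = ⌊ ⟨ p ⟩ ∪ ｛ x ｝ ⌋
    extend p (no _)        = p

    extend-inflationary : ∀ p d → p ⊑ extend p d
    extend-inflationary p (yes (y , _)) x = ∈⌊⌋⁺ (⟨ p ⟩ ∪ ｛ y ｝) ∘ inj₁
    extend-inflationary p (no _)        x = id

    extend-admissible : ∀ p d → Admissible ⟨ p ⟩ → Admissible ⟨ extend p d ⟩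
    extend-admissible p (yes (x , _ , adm)) _   = adm ∘ All.map (∈⌊⌋⁻ (⟨ p ⟩ ∪ ｛ x ｝))
    extend-admissible p (no _)              adm = adm

    extend-maximal : ∀ p d → extend p d ⊑ p → ¬ Extension p
    extend-maximal p (yes (x , x∉p , _)) closed _ =
      x∉p (closed x (∈⌊⌋⁺ (⟨ p ⟩ ∪ ｛ x ｝) (inj₂ refl)))
    extend-maximal p (no ¬ext) _ = ¬ext

    open Iterate (λ p → extend p em) (λ p → extend-inflationary p em)

    -- Of the stages covering the head and the tail, the larger covers both. The list is nonempty
    -- because an empty family has no member to offer.
    finite⊑⋃ : ∀ {𝒫} → (∀ p → 𝒫 p ≡ true → Tower p) → ∀ {x xs} →
               All ⟨ ⋃ 𝒫 ⟩ (x ∷ xs) → ∃ λ p → 𝒫 p ≡ true × All ⟨ p ⟩ (x ∷ xs)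
    finite⊑⋃ ts (x∈⋃ ∷ []) with ∈⋃⁻ x∈⋃
    ... | p , p∈𝒫 , x∈p = p , p∈𝒫 , x∈p ∷ []
    finite⊑⋃ ts (x∈⋃ ∷ xs∈⋃@(_ ∷ _)) with ∈⋃⁻ x∈⋃ | finite⊑⋃ ts xs∈⋃
    ... | p , p∈𝒫 , x∈p | q , q∈𝒫 , xs∈q with tower-total (ts p p∈𝒫) (ts q q∈𝒫)
    ...   | inj₁ p⊑q = q , q∈𝒫 , p⊑q _ x∈p ∷ xs∈q
    ...   | inj₂ q⊑p = p , p∈𝒫 , x∈p ∷ All.map (q⊑p _) xs∈q

    tower-admissible : ∀ {p} → Tower p → Admissible ⟨ p ⟩
    tower-admissible (next {p} tp) = extend-admissible p em (tower-admissible tp)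
    tower-admissible (limit 𝒫 ts) []            = Q[]
    tower-admissible (limit 𝒫 ts) xs∈⋃@(_ ∷ _) with finite⊑⋃ ts xs∈⋃
    ... | p , p∈𝒫 , xs∈p = tower-admissible (ts p p∈𝒫) xs∈p

    tukey : ∃ λ m → Admissible ⟨ m ⟩ ×
                    (∀ {x} → ¬ x ∈ ⟨ m ⟩ → ¬ Admissible (⟨ m ⟩ ∪ ｛ x ｝))
    tukey = top , tower-admissible tower-top , λ x∉m adm →
      extend-maximal top em top-closed (_ , x∉m , adm)

-- Propositional derivations

cut : (∀ {X} → X ∈ S → S′ ⊢ X) → S ⊢ Y → S′ ⊢ Y
cut σ (hyp X∈S) = σ X∈S
cut σ (ax a)    = ax a
cut σ (mp d e)  = mp (cut σ d) (cut σ e)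

⊢-K : S ⊢ Y → S ⊢ X ⇒ Y
⊢-K = mp (ax ⇒-K)

⊢-S : S ⊢ X ⇒ Y ⇒ Z → S ⊢ X ⇒ Y → S ⊢ X ⇒ Z
⊢-S d e = mp (mp (ax ⇒-S) d) e

⊢-id : S ⊢ X ⇒ X
⊢-id {X = X} = ⊢-S (ax ⇒-K) (ax (⇒-K {Y = X}))

deduction : S ∪ ｛ X ｝ ⊢ Y → S ⊢ X ⇒ Y
deduction (hyp (inj₁ Y∈S))  = ⊢-K (hyp Y∈S)
deduction (hyp (inj₂ refl)) = ⊢-id
deduction (ax a)            = ⊢-K (ax a)
deduction (mp d e)          = ⊢-S (deduction d) (deduction e)

⊢-∼I : S ⊢ X ⇒ Y → S ⊢ X ⇒ ∼ Y → S ⊢ ∼ X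
⊢-∼I d e = mp (mp (ax ∼-I) d) e

⊢-explosion : S ⊢ ∼ X → S ⊢ X → S ⊢ Y
⊢-explosion d e = mp (ax ∼∼-E) (⊢-∼I (⊢-K e) (⊢-K d))

⊢-contraposition : S ⊢ X ⇒ Y → S ⊢ ∼ Y ⇒ ∼ X
⊢-contraposition d =
  deduction (⊢-∼I (cut (hyp ∘ inj₁) d) (⊢-K (hyp (inj₂ refl))))

-- By contraposition `∼ Y` implies both `∼ X` and `∼ ∼ X`, so `∼ ∼ Y` is derivable.
⊢-cases : S ⊢ X ⇒ Y → S ⊢ ∼ X ⇒ Y → S ⊢ Y
⊢-cases d e = mp (ax ∼∼-E) (⊢-∼I (⊢-contraposition d) (⊢-contraposition e))

-- A derivation is a finite tree, so it uses finitely many members of `P`; `S` stays whole, since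
-- only the added formulas are collected in lists.
finite-support : {P : Pred (Fm Atom Tm) 0ℓ} → S ∪ P ⊢ X →
                 ∃ λ xs → All P xs × S ∪ (_∈ˡ xs) ⊢ X
finite-support (hyp (inj₁ X∈S)) = [] , [] , hyp (inj₁ X∈S)
finite-support {X = X} (hyp (inj₂ X∈P)) = [ X ] , X∈P ∷ [] , hyp (inj₂ (here refl))
finite-support (ax a)           = [] , [] , ax a
finite-support (mp d e) with finite-support d | finite-support e
... | xs , xs∈P , d′ | ys , ys∈P , e′ =
  xs ++ ys , ++⁺ xs∈P ys∈P ,
  mp (cut (hyp ∘ Sum.map₂ ∈-++⁺ˡ) d′) (cut (hyp ∘ Sum.map₂ (∈-++⁺ʳ xs)) e′)

-- Soundness: the axioms are Boolean tautologies

module Soundness (M : BasicModel Atom Tm) where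
  open BasicModel M

  ⇒-intro : (M ⊨ X → M ⊨ Y) → M ⊨ X ⇒ Y
  ⇒-intro {X = X} {Y} f with ⟦ X ⟧ in eq
  ... | true  = from (⇒-true X Y) (inj₂ (f refl))
  ... | false = from (⇒-true X Y) (inj₁ eq)

  ⇒-elim : M ⊨ X ⇒ Y → M ⊨ X → M ⊨ Y
  ⇒-elim {X = X} {Y} f x with to (⇒-true X Y) f
  ... | inj₁ x≡false = ⊥-elim (true≢false x x≡false)
  ... | inj₂ y       = y

  ∼-intro : ¬ M ⊨ X → M ⊨ ∼ X
  ∼-intro {X = X} ¬x = from (∼-true X) (¬-not ¬x)

  ∼-elim : M ⊨ ∼ X → ¬ M ⊨ X
  ∼-elim {X = X} n x = true≢false x (to (∼-true X) n)

  ∼∼-elim : M ⊨ ∼ ∼ X → M ⊨ X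
  ∼∼-elim {X = X} nn with ⟦ X ⟧ in eq
  ... | true  = refl
  ... | false = ⊥-elim (∼-elim nn (from (∼-true X) eq))

  axiom-sound : Axiom X → M ⊨ X
  axiom-sound ⇒-K  = ⇒-intro λ x → ⇒-intro λ _ → x
  axiom-sound ⇒-S  = ⇒-intro λ f → ⇒-intro λ g → ⇒-intro λ x →
    ⇒-elim (⇒-elim f x) (⇒-elim g x)
  axiom-sound ∧-I  = ⇒-intro λ x → ⇒-intro λ y → from (∧-true _ _) (x , y)
  axiom-sound ∧-E₁ = ⇒-intro (proj₁ ∘ to (∧-true _ _))
  axiom-sound ∧-E₂ = ⇒-intro (proj₂ ∘ to (∧-true _ _))
  axiom-sound ∨-I₁ = ⇒-intro (from (∨-true _ _) ∘ inj₁)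
  axiom-sound ∨-I₂ = ⇒-intro (from (∨-true _ _) ∘ inj₂)
  axiom-sound ∨-E  = ⇒-intro λ f → ⇒-intro λ g → ⇒-intro λ xy →
    [ ⇒-elim f , ⇒-elim g ]′ (to (∨-true _ _) xy)
  axiom-sound ∼-I  = ⇒-intro λ f → ⇒-intro λ g → ∼-intro λ x →
    ∼-elim (⇒-elim g x) (⇒-elim f x)
  axiom-sound ∼∼-E = ⇒-intro ∼∼-elim

  sound : M ∈ BM S → S ⊢ X → M ⊨ X
  sound M∈BM (hyp X∈S) = M∈BM _ X∈S
  sound M∈BM (ax a)    = axiom-sound a
  sound M∈BM (mp d e)  = ⇒-elim (sound M∈BM d) (sound M∈BM e)

-- The canonical countermodel of an underivable formula

module Completeness (em : ExcludedMiddle 0ℓ) (ext : Extensionality 0ℓ 0ℓ)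
                    (S : Pred (Fm Atom Tm) 0ℓ) (F : Fm Atom Tm) (S⊬F : ¬ S ⊢ F) where

  open Choice em ext

  Safe : List (Fm Atom Tm) → Set
  Safe xs = ¬ S ∪ (_∈ˡ xs) ⊢ F

  maximal = tukey Safe (S⊬F ∘ cut λ where (inj₁ X∈S) → hyp X∈S)

  val : Fm Atom Tm → Bool
  val = proj₁ maximal

  -- `S` is joined explicitly; that the maximal set already contains it follows from
  -- `provable-true`.
  Γ : Pred (Fm Atom Tm) 0ℓ
  Γ = S ∪ λ X → val X ≡ true

  Γ⊬F : ¬ Γ ⊢ F
  Γ⊬F d with finite-support d
  ... | xs , xs∈m , d′ = proj₁ (proj₂ maximal) xs∈m d′

  -- Otherwise, by the deduction theorem, no list from the maximal set together with `X` derives `F`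
  -- over `S`, which contradicts maximality.
  refutes : val X ≡ false → Γ ⊢ X ⇒ F
  refutes {X} X≡false with em {Γ ⊢ X ⇒ F}
  ... | yes d = d
  ... | no ¬d = ⊥-elim (proj₂ (proj₂ maximal) (λ X∈m → true≢false X∈m X≡false)
    λ xs∈ d → ¬d (deduction (cut (λ where
      (inj₁ Y∈S)  → hyp (inj₁ (inj₁ Y∈S))
      (inj₂ Y∈xs) → hyp (Sum.map₁ inj₂ (All.lookup xs∈ Y∈xs))) d)))

  proves : val X ≡ true → Γ ⊢ X
  proves X∈m = hyp (inj₂ X∈m)

  -- A derivable formula with value false would yield `F` through `refutes`, so the maximal set is
  -- deductively closed.
  provable-true : Γ ⊢ X → val X ≡ true
  provable-true {X} d = ¬-not λ X≡false → Γ⊬F (mp (refutes X≡false) d)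

  val-∼⁺ : val X ≡ false → val (∼ X) ≡ true
  val-∼⁺ X≡false = ¬-not λ ∼X≡false → Γ⊬F (⊢-cases (refutes X≡false) (refutes ∼X≡false))

  val-∼⁻ : val (∼ X) ≡ true → val X ≡ false
  val-∼⁻ n = ¬-not λ x → Γ⊬F (⊢-explosion (proves n) (proves x))

  -- If both disjuncts were false, each would imply `F`, and so would the disjunction.
  val-∨⁻ : val (X ∨ Y) ≡ true → val X ≡ true ⊎ val Y ≡ true
  val-∨⁻ {X} {Y} d with val X in x | val Y in y
  ... | true  | _     = inj₁ refl
  ... | false | true  = inj₂ refl
  ... | false | false =
    ⊥-elim (Γ⊬F (mp (mp (mp (ax ∨-E) (refutes x)) (refutes y)) (proves d)))

  val-⇒⁺ : val X ≡ false ⊎ val Y ≡ true → val (X ⇒ Y) ≡ true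
  val-⇒⁺ (inj₁ X≡false) = provable-true
    (deduction (⊢-explosion (hyp (inj₁ (inj₂ (val-∼⁺ X≡false)))) (hyp (inj₂ refl))))
  val-⇒⁺ (inj₂ y)       = provable-true (⊢-K (proves y))

  val-⇒⁻ : val (X ⇒ Y) ≡ true → val X ≡ false ⊎ val Y ≡ true
  val-⇒⁻ {X} f with val X in x
  ... | true  = inj₂ (provable-true (mp (proves f) (proves x)))
  ... | false = inj₁ refl

  canonical : BasicModel Atom Tm
  canonical = record
    { ⟦_⟧    = val
    ; ⟪_⟫    = λ t X → val (t ∶ X) ≡ true
    ; ∼-true = λ _ → mk⇔ val-∼⁻ val-∼⁺
    ; ∧-true = λ _ _ → mk⇔
        (λ d → provable-true (mp (ax ∧-E₁) (proves d)) ,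
               provable-true (mp (ax ∧-E₂) (proves d)))
        (λ (x , y) → provable-true (mp (mp (ax ∧-I) (proves x)) (proves y)))
    ; ∨-true = λ _ _ → mk⇔ val-∨⁻
        [ provable-true ∘ mp (ax ∨-I₁) ∘ proves , provable-true ∘ mp (ax ∨-I₂) ∘ proves ]′
    ; ⇒-true = λ _ _ → mk⇔ val-⇒⁻ val-⇒⁺
    ; ∶-true = λ _ _ → mk⇔ id id
    }

  canonical∈BM : canonical ∈ BM S
  canonical∈BM X X∈S = provable-true (hyp (inj₁ X∈S))

  canonical⊭F : ¬ canonical ⊨ F
  canonical⊭F = Γ⊬F ∘ proves

theorem1 : ExcludedMiddle 0ℓ → Extensionality 0ℓ 0ℓ →
    (Atom Tm : Set) (S : Pred (Fm Atom Tm) 0ℓ) (F : Fm Atom Tm) →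
    S ⊢ F ⇔ (∀ (M : BasicModel Atom Tm) → M ∈ BM S → M ⊨ F)
theorem1 em ext Atom Tm S F = mk⇔ (λ d M M∈BM → Soundness.sound M M∈BM d) complete
  where
  complete : (∀ (M : BasicModel Atom Tm) → M ∈ BM S → M ⊨ F) → S ⊢ F
  complete valid with em {S ⊢ F}
  ... | yes d  = d
  ... | no S⊬F = ⊥-elim (canonical⊭F (valid canonical canonical∈BM))
    where open Completeness em ext S F S⊬F
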